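{- Let $G$ be a $(P_3+P_1)$-free graph on $n$ vertices and let $\ell \ge \chi(G)+1$ be an integer. Then $\mathcal{R}_\ell(G)$ is connected and has diameter at most $6n$.
   Context: All graphs are finite and simple. A $k$-colouring of $G$ is a map $\alpha: V(G)\to\{1,\dots,k\}$ with $\alpha(u)\neq\alpha(v)$ for every edge $uv$; $\chi(G)$ is the chromatic number. The reconfiguration graph $\mathcal{R}_k(G)$ has the $k$-colourings of $G$ as vertices, two being adjacent if they differ on exactly one vertex. $G$ is $H$-free if it has no induced subgraph isomorphic to $H$; $P_3+P_1$ is the disjoint union of a path on 3 vertices and a single vertex. -}

module Defs where

open import Data.Fin.Base using (Fin; toℕ)
open import Data.Fin.Properties using (_≟_; any?; all?)
open import Data.Fin.Subset using (Subset; _∈_)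
open import Data.Nat.Base using (ℕ; zero; suc; _≤_; _<_)
open import Data.Nat.Induction using (<-rec)
open import Data.Nat.Properties using (anyUpTo?; ≮⇒≥; 1+n≢n)
import Data.Nat.Properties as ℕ
open import Data.Product using (∃!)
open import Data.Product.Base using (Σ; ∃; _×_; _,_; proj₁)
open import Data.Sum.Base using (_⊎_; swap; [_,_])
open import Data.Sum.Relation.Binary.Pointwise
  using (Pointwise; inj₁; inj₂; ⊎-symmetric; ⊎-decidable)
open import Data.Vec.Base using (Vec; []; _∷_; lookup; allFin)
open import Data.Vec.Properties using (lookup-allFin)
open import Function.Base using (_on_; _∘_)
open import Function.Bundles using (_↔_; _⇔_; Inverse)
open import Level using (0ℓ)
open import Relation.Binary.Construct.Closure.ReflexiveTransitive using (Star; fold)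
open import Relation.Binary.Core using (Rel)
open import Relation.Binary.Definitions using (Symmetric; Irreflexive; Decidable)
open import Relation.Binary.PropositionalEquality.Core
  using (_≡_; _≢_; refl; sym; trans)
open import Relation.Nullary.Decidable
  using (Dec; yes; no; map′; recompute; ¬?; _×-dec_; _⊎-dec_; _→-dec_)
open import Relation.Nullary.Negation.Core using (¬_)
import Relation.Unary as U

-- Simple graphs with vertex set V. Adjacency is decidable, as it classically
-- always is. A finite graph on n vertices is a Graph (Fin n).

record Graph (V : Set) : Set₁ where
  field
    Adj    : Rel V 0ℓ
    symm   : Symmetric Adj
    irrefl : Irreflexive _≡_ Adj
    adj?   : Decidable Adj

open Graph public

Path : ∀ m → Graph (Fin m)
Path m .Adj i j = suc (toℕ i) ≡ toℕ j ⊎ suc (toℕ j) ≡ toℕ i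
Path m .symm = swap
Path m .irrefl refl = [ 1+n≢n , 1+n≢n ]
Path m .adj? i j = (suc (toℕ i) ℕ.≟ toℕ j) ⊎-dec (suc (toℕ j) ℕ.≟ toℕ i)

infixl 6 _⊕_

_⊕_ : ∀ {V W} → Graph V → Graph W → Graph (V ⊎ W)
(G ⊕ H) .Adj = Pointwise (Adj G) (Adj H)
(G ⊕ H) .symm = ⊎-symmetric (symm G) (symm H)
(G ⊕ H) .irrefl refl (inj₁ e) = irrefl G refl e
(G ⊕ H) .irrefl refl (inj₂ e) = irrefl H refl e
(G ⊕ H) .adj? = ⊎-decidable (adj? G) (adj? H)

_[_] : ∀ {n} → Graph (Fin n) → (S : Subset n) → Graph (∃ (_∈ S))
(G [ S ]) .Adj = Adj G on proj₁
(G [ S ]) .symm = symm G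
(G [ S ]) .irrefl refl = irrefl G refl
(G [ S ]) .adj? (u , _) (v , _) = adj? G u v

_≅_ : ∀ {V W} → Graph V → Graph W → Set
_≅_ {V} {W} G H =
  Σ (V ↔ W) λ f → ∀ u v → Adj G u v ⇔ Adj H (Inverse.to f u) (Inverse.to f v)

Free : ∀ {W n} → Graph W → Graph (Fin n) → Set
Free H G = ∀ S → ¬ (H ≅ (G [ S ]))

Proper : ∀ {k n} → Graph (Fin n) → Vec (Fin k) n → Set
Proper G α = ∀ u v → Adj G u v → lookup α u ≢ lookup α v

-- Maps Fin n → Fin k are represented by vectors and properness is irrelevant,
-- so that _≡_ on colourings is equality of the underlying maps.

record Colouring (k : ℕ) {n : ℕ} (G : Graph (Fin n)) : Set where
  constructor colouring
  field
    colours : Vec (Fin k) n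
    .proper : Proper G colours

  colour : Fin n → Fin k
  colour = lookup colours

open Colouring public

IsChromaticNumber : ∀ {n} → Graph (Fin n) → ℕ → Set
IsChromaticNumber G c = Colouring c G × (∀ k → Colouring k G → c ≤ k)

anyVec? : ∀ {k n} {P : U.Pred (Vec (Fin k) n) 0ℓ} → U.Decidable P → Dec (∃ P)
anyVec? {n = zero} P? = map′ (λ p → [] , p) (λ { ([] , p) → p }) (P? [])
anyVec? {n = suc n} P? =
  map′ (λ { (x , xs , p) → x ∷ xs , p }) (λ { (x ∷ xs , p) → x , xs , p })
       (any? λ x → anyVec? λ xs → P? (x ∷ xs))

proper? : ∀ {k n} (G : Graph (Fin n)) → U.Decidable (Proper {k} G)
proper? G α =
  all? λ u → all? λ v → adj? G u v →-dec ¬? (lookup α u ≟ lookup α v)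

colouring? : ∀ {n} (G : Graph (Fin n)) → U.Decidable (λ k → Colouring k G)
colouring? G k =
  map′ (λ { (α , p) → colouring α p })
       (λ { (colouring α p) → α , recompute (proper? G α) p })
       (anyVec? (proper? G))

least : {P : U.Pred ℕ 0ℓ} → U.Decidable P → ∀ n → P n →
        ∃ λ m → P m × (∀ k → P k → m ≤ k)
least {P} P? = <-rec _ step
  where
  step : ∀ n → (∀ {m} → m < n → P m → ∃ λ m → P m × (∀ k → P k → m ≤ k)) →
         P n → ∃ λ m → P m × (∀ k → P k → m ≤ k)
  step n rec pn with anyUpTo? P? n
  ... | yes (m , m<n , pm) = rec m<n pm
  ... | no ¬p = n , pn , λ k pk → ≮⇒≥ λ k<n → ¬p (k , k<n , pk)

chromaticNumber : ∀ {n} (G : Graph (Fin n)) → ∃ (IsChromaticNumber G)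
chromaticNumber {n} G =
  least (colouring? G) n (colouring (allFin n) λ u v e eq →
    irrefl G (trans (sym (lookup-allFin u)) (trans eq (lookup-allFin v))) e)

χ : ∀ {n} → Graph (Fin n) → ℕ
χ G = proj₁ (chromaticNumber G)

Differ : ∀ {k n} {G : Graph (Fin n)} → Colouring k G → Colouring k G → Fin n → Set
Differ α β v = colour α v ≢ colour β v

𝓡 : ∀ k {n} (G : Graph (Fin n)) → Graph (Colouring k G)
𝓡 k G .Adj α β = ∃! _≡_ (Differ α β)
𝓡 k G .symm (v , d , unique) = v , d ∘ sym , λ d′ → unique (d′ ∘ sym)
𝓡 k G .irrefl refl (v , d , _) = d refl
𝓡 k G .adj? α β =
  map′ (λ { (v , d , u) → v , d , λ {w} → u w })
       (λ { (v , d , u) → v , d , λ w → u {w} })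
       (any? λ v → differ? v ×-dec all? λ w → differ? w →-dec (v ≟ w))
  where
  differ? : U.Decidable (Differ α β)
  differ? v = ¬? (colour α v ≟ colour β v)

Walk : ∀ {V} → Graph V → Rel V 0ℓ
Walk G = Star (Adj G)

length : ∀ {V} (G : Graph V) {u v : V} → Walk G u v → ℕ
length G = fold (λ _ _ → ℕ) (λ _ → suc) 0

Connected : ∀ {V} → Graph V → Set
Connected G = ∀ u v → Walk G u v

IsDistance : ∀ {V} → Graph V → V → V → ℕ → Set
IsDistance G u v d =
  (∃ λ (p : Walk G u v) → length G p ≡ d) × (∀ (p : Walk G u v) → d ≤ length G p)

-- The maximum distance between two vertices. No number is a diameter of a
-- disconnected graph or of a graph without vertices.

IsDiameter : ∀ {V} → Graph V → ℕ → Set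
IsDiameter G D =
  (∀ u v → ∃ λ d → IsDistance G u v d × d ≤ D) ×
  (∃ λ u → ∃ λ v → IsDistance G u v D)

{-# OPTIONS --safe #-}

-- Fix an optimal colouring γ with classes indexed by Fin k, k < ℓ. Any
-- ℓ-colouring can be brought into the form ι ∘ γ, ι injective, with 2n
-- recolourings, and two colourings of this form are 2n apart; hence 6n.
--
-- For the first claim, work on a set Γ of γ-classes with a larger palette P of
-- colours not used outside Γ. If all occurrences of some p ∈ P lie in one class,
-- give the whole class colour p and continue without both. Otherwise every p
-- occurs twice, so by counting some class contains an independent triple t. By
-- (P₃+P₁)-freeness the vertices not complete to t form a block which is complete
-- to its complement and P₃-free, so that both colourings split along it and one
-- of the two sides still has more colours than classes. Treat that side first:
-- the colours it saves are then available to the other side. In the block each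
-- component is a clique with fewer vertices than there are colours, and a vertex
-- can be moved to its target after evicting at most one blocker.

module Submission where

open import Defs
open import Algebra.Properties.Semiring.Sum using (sum; ∑-comm; ∑-distrib-+; *-distribˡ-sum)
open import Data.Bool.Base using (true)
open import Data.Empty using (⊥)
open import Data.Fin.Base using (Fin; zero; suc; inject≤)
open import Data.Fin.Patterns using (0F; 1F; 2F)
open import Data.Fin.Properties using (_≟_; any?; all?; suc-injective; inject≤-injective)
open import Data.Fin.Subset using (Subset; _∈_)
open import Data.Nat.Base using (ℕ; zero; suc; _+_; _*_; _≤_; _<_; _≥_; z≤n; s≤s)
open import Data.Nat.Properties
  using (≤-refl; ≤-reflexive; ≤-trans; ≤-pred; <⇒≤; <⇒≱; ≮⇒≥; m≤m+n; m≤n+m; +-assoc;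
         +-identityʳ; *-distribˡ-+; +-mono-≤; +-monoˡ-≤; *-monoʳ-≤; +-*-semiring;
         module ≤-Reasoning)
import Data.Nat.Properties as ℕ
open import Data.Product.Base using (Σ; ∃; ∃-syntax; _×_; _,_; proj₁; proj₂)
import Data.Sum.Base as Sum
open import Data.Sum.Base using (_⊎_; inj₁; inj₂)
import Data.Sum.Relation.Binary.Pointwise as Pointwise
open import Data.Unit.Base using (⊤; tt)
import Data.Vec.Base as Vec
open import Data.Vec.Base using (lookup; tabulate) renaming (_[_]≔_ to _⟨_⟩≔_)
open import Data.Vec.Functional using (updateAt)
open import Data.Vec.Functional.Properties using (updateAt-updates; updateAt-minimal)
open import Data.Vec.Properties
  using (lookup⇒[]=; []=⇒lookup; lookup∘tabulate; tabulate∘lookup; tabulate-cong;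
         lookup∘update; lookup∘update′; lookup-map; ≡-dec)
open import Data.Vec.Properties.WithK using ([]=-irrelevant)
open import Function.Base using (_∘_; const; id)
open import Function.Bundles using (mk↔ₛ′; mk⇔)
open import Level using (0ℓ)
open import Relation.Binary.Construct.Closure.ReflexiveTransitive using (ε; _◅_; _◅◅_)
open import Relation.Binary.PropositionalEquality.Core
  using (_≡_; _≢_; refl; sym; trans; cong; subst; ≢-sym)
open import Relation.Nullary.Decidable
  using (Dec; yes; no; does; map′; recompute; ¬?; _×-dec_; _⊎-dec_; _→-dec_; decidable-stable)
open import Relation.Nullary.Negation.Core using (¬_; contradiction)
open import Relation.Unary using (Pred; Decidable)

-- Counting in Fin n

∑ : ∀ {n} → (Fin n → ℕ) → ℕ
∑ = sum +-*-semiring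

⟦_⟧ : ∀ {A : Set} → Dec A → ℕ
⟦ yes _ ⟧ = 1
⟦ no _ ⟧ = 0

count : ∀ {n} {P : Pred (Fin n) 0ℓ} → Decidable P → ℕ
count P? = ∑ λ i → ⟦ P? i ⟧

∑-mono : ∀ {n} {f g : Fin n → ℕ} → (∀ i → f i ≤ g i) → ∑ f ≤ ∑ g
∑-mono {zero} f≤g = z≤n
∑-mono {suc n} f≤g = +-mono-≤ (f≤g zero) (∑-mono (f≤g ∘ suc))

module _ {n : ℕ} {P Q : Pred (Fin n) 0ℓ} (P? : Decidable P) (Q? : Decidable Q) where

  count-mono : (∀ {i} → P i → Q i) → count P? ≤ count Q?
  count-mono P⊆Q = ∑-mono pointwise
    where
    pointwise : ∀ i → ⟦ P? i ⟧ ≤ ⟦ Q? i ⟧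
    pointwise i with P? i | Q? i
    ... | no _ | _ = z≤n
    ... | yes _ | yes _ = ≤-refl
    ... | yes p | no ¬q = contradiction (P⊆Q p) ¬q

module _ {n : ℕ} {P Q R : Pred (Fin n) 0ℓ}
         (P? : Decidable P) (Q? : Decidable Q) (R? : Decidable R) where

  count-disjoint : (∀ {i} → P i → ¬ Q i) → (∀ {i} → P i → R i) → (∀ {i} → Q i → R i) →
                   count P? + count Q? ≤ count R?
  count-disjoint P∩Q=∅ P⊆R Q⊆R =
    ≤-trans (≤-reflexive (sym (∑-distrib-+ +-*-semiring (λ i → ⟦ P? i ⟧) _))) (∑-mono pointwise)
    where
    pointwise : ∀ i → ⟦ P? i ⟧ + ⟦ Q? i ⟧ ≤ ⟦ R? i ⟧
    pointwise i with P? i | Q? i | R? i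
    ... | no _ | no _ | _ = z≤n
    ... | yes p | yes q | _ = contradiction q (P∩Q=∅ p)
    ... | yes p | no _ | no ¬r = contradiction (P⊆R p) ¬r
    ... | no _ | yes q | no ¬r = contradiction (Q⊆R q) ¬r
    ... | yes _ | no _ | yes _ = ≤-refl
    ... | no _ | yes _ | yes _ = ≤-refl

  count-cover : (∀ {i} → R i → P i ⊎ Q i) → count R? ≤ count P? + count Q?
  count-cover R⊆P∪Q =
    ≤-trans (∑-mono pointwise) (≤-reflexive (∑-distrib-+ +-*-semiring (λ i → ⟦ P? i ⟧) _))
    where
    pointwise : ∀ i → ⟦ R? i ⟧ ≤ ⟦ P? i ⟧ + ⟦ Q? i ⟧
    pointwise i with R? i | P? i | Q? i
    ... | no _ | _ | _ = z≤n
    ... | yes _ | yes _ | _ = s≤s z≤n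
    ... | yes _ | no _ | yes _ = ≤-refl
    ... | yes r | no ¬p | no ¬q with R⊆P∪Q r
    ...   | inj₁ p = contradiction p ¬p
    ...   | inj₂ q = contradiction q ¬q

count-pos : ∀ {n} {P : Pred (Fin n) 0ℓ} (P? : Decidable P) {i} → P i → 1 ≤ count P?
count-pos P? {zero} p with P? zero
... | yes _ = s≤s z≤n
... | no ¬p = contradiction p ¬p
count-pos P? {suc i} p = ≤-trans (count-pos (P? ∘ suc) p) (m≤n+m _ ⟦ P? zero ⟧)

count-nonempty : ∀ {n} {P : Pred (Fin n) 0ℓ} (P? : Decidable P) → 1 ≤ count P? → ∃ P
count-nonempty {suc n} P? 1≤ with P? zero
... | yes p = zero , p
... | no _ with count-nonempty (P? ∘ suc) 1≤
...   | i , p = suc i , p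

count-≤1 : ∀ {n} {P : Pred (Fin n) 0ℓ} (P? : Decidable P) →
           (∀ {i j} → P i → P j → i ≡ j) → count P? ≤ 1
count-≤1 {zero} P? unique = z≤n
count-≤1 {suc n} P? unique with P? zero
... | no _ = count-≤1 (P? ∘ suc) λ p q → suc-injective (unique p q)
... | yes p = s≤s (≮⇒≥ λ 1≤ → let i , q = count-nonempty (P? ∘ suc) 1≤ in
                contradiction (unique p q) λ ())

count-≤n : ∀ {n} {P : Pred (Fin n) 0ℓ} (P? : Decidable P) → count P? ≤ n
count-≤n {zero} P? = z≤n
count-≤n {suc n} P? with P? zero
... | yes _ = s≤s (count-≤n (P? ∘ suc))
... | no _ = ℕ.m≤n⇒m≤1+n (count-≤n (P? ∘ suc))

count-full : ∀ {n} → n ≤ count {n} (λ _ → yes tt)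
count-full {zero} = z≤n
count-full {suc n} = s≤s count-full

module _ {n : ℕ} {P Q : Pred (Fin n) 0ℓ} (P? : Decidable P) (Q? : Decidable Q) where

  count-< : ∀ {i} → (∀ {j} → P j → Q j) → ¬ P i → Q i → count P? < count Q?
  count-< {i} P⊆Q ¬p q =
    ≤-trans (+-monoˡ-≤ (count P?) (count-pos (_≟ i) refl))
            (count-disjoint (_≟ i) P? Q? (λ { refl → ¬p }) (λ { refl → q }) P⊆Q)

infixl 6 _-?_

_-?_ : ∀ {n} {P : Pred (Fin n) 0ℓ} → Decidable P → (x : Fin n) →
       Decidable (λ i → P i × i ≢ x)
(P? -? x) i = P? i ×-dec ¬? (i ≟ x)

count-remove : ∀ {n} {P : Pred (Fin n) 0ℓ} (P? : Decidable P) x →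
               count P? ≤ suc (count (P? -? x))
count-remove P? x =
  ≤-trans (count-cover (_≟ x) (P? -? x) P? split)
          (+-monoˡ-≤ _ (count-≤1 (_≟ x) λ p q → trans p (sym q)))
  where
  split : ∀ {i} → _ → i ≡ x ⊎ _
  split {i} p with i ≟ x
  ... | yes i≡x = inj₁ i≡x
  ... | no i≢x = inj₂ (p , i≢x)

count-≥2 : ∀ {n} {P : Pred (Fin n) 0ℓ} (P? : Decidable P) {i j} → P i → P j → i ≢ j →
           2 ≤ count P?
count-≥2 P? {i} {j} p q i≢j =
  ≤-trans (s≤s (count-pos (_≟ j) refl)) (count-< (_≟ j) P? (λ { refl → q }) i≢j p)

count-≥3⁻¹ : ∀ {n} {P : Pred (Fin n) 0ℓ} (P? : Decidable P) → 3 ≤ count P? →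
             ∃ λ (t : Fin 3 → Fin n) → (∀ i → P (t i)) × (∀ {i j} → i ≢ j → t i ≢ t j)
count-≥3⁻¹ P? 3≤ with count-nonempty P? (≤-trans (s≤s z≤n) 3≤)
... | x , p with ≤-pred (≤-trans 3≤ (count-remove P? x))
... | 2≤ with count-nonempty (P? -? x) (≤-trans (s≤s z≤n) 2≤)
... | y , q , y≢x with count-nonempty (P? -? x -? y) (≤-pred (≤-trans 2≤ (count-remove (P? -? x) y)))
... | z , (r , z≢x) , z≢y = t , all , distinct
  where
  t : Fin 3 → _
  t zero = x
  t (suc zero) = y
  t (suc (suc zero)) = z
  all : ∀ i → _
  all zero = p
  all (suc zero) = q
  all (suc (suc zero)) = r
  distinct : ∀ {i j} → i ≢ j → t i ≢ t j
  distinct {zero} {zero} i≢j = λ _ → i≢j refl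
  distinct {zero} {suc zero} _ = ≢-sym y≢x
  distinct {zero} {suc (suc zero)} _ = ≢-sym z≢x
  distinct {suc zero} {zero} _ = y≢x
  distinct {suc zero} {suc zero} i≢j = λ _ → i≢j refl
  distinct {suc zero} {suc (suc zero)} _ = ≢-sym z≢y
  distinct {suc (suc zero)} {zero} _ = z≢x
  distinct {suc (suc zero)} {suc zero} _ = z≢y
  distinct {suc (suc zero)} {suc (suc zero)} i≢j = λ _ → i≢j refl

-- Both sides are compared with the number of pairs in `R`, summed by rows and by columns. Rows
-- outside `P` can only enlarge this sum, while columns outside `Q` are empty by `R⊆Q`.
double-count : ∀ {m n} {P : Pred (Fin m) 0ℓ} {Q : Pred (Fin n) 0ℓ} {R : Fin m → Fin n → Set}
  (P? : Decidable P) (Q? : Decidable Q) (R? : ∀ i j → Dec (R i j)) a b →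
  (∀ i → P i → a ≤ count (R? i)) →
  (∀ j → Q j → count (λ i → R? i j) ≤ b) →
  (∀ {i j} → R i j → Q j) →
  a * count P? ≤ b * count Q?
double-count {m} {n} P? Q? R? a b lower upper R⊆Q = begin
  a * count P? ≡⟨ *-distribˡ-sum +-*-semiring a (λ i → ⟦ P? i ⟧) ⟩
  ∑ (λ i → a * ⟦ P? i ⟧) ≤⟨ ∑-mono left ⟩
  ∑ (λ i → count (R? i)) ≡⟨ ∑-comm +-*-semiring (λ i j → ⟦ R? i j ⟧) ⟩
  ∑ (λ j → count (λ i → R? i j)) ≤⟨ ∑-mono right ⟩
  ∑ (λ j → b * ⟦ Q? j ⟧) ≡⟨ sym (*-distribˡ-sum +-*-semiring b (λ j → ⟦ Q? j ⟧)) ⟩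
  b * count Q? ∎
  where
  open ≤-Reasoning
  left : ∀ i → a * ⟦ P? i ⟧ ≤ count (R? i)
  left i with P? i
  ... | yes p = ≤-trans (≤-reflexive (ℕ.*-identityʳ a)) (lower i p)
  ... | no _ = ≤-trans (≤-reflexive (ℕ.*-zeroʳ a)) z≤n
  right : ∀ j → count (λ i → R? i j) ≤ b * ⟦ Q? j ⟧
  right j with Q? j
  ... | yes q = ≤-trans (upper j q) (≤-reflexive (sym (ℕ.*-identityʳ b)))
  ... | no ¬q = ≤-trans (≮⇒≥ λ 1≤ → ¬q (R⊆Q (proj₂ (count-nonempty (λ i → R? i j) 1≤)))) z≤n

injective⇒count≤ : ∀ {m n} {P : Pred (Fin m) 0ℓ} {Q : Pred (Fin n) 0ℓ} {R : Fin m → Fin n → Set}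
  (P? : Decidable P) (Q? : Decidable Q) (R? : ∀ i j → Dec (R i j)) →
  (∀ i → P i → ∃ (R i)) →
  (∀ {i i′ j} → R i j → R i′ j → i ≡ i′) →
  (∀ {i j} → R i j → Q j) →
  count P? ≤ count Q?
injective⇒count≤ P? Q? R? total unique R⊆Q =
  ℕ.*-cancelˡ-≤ 1 (double-count P? Q? R? 1 1 (λ i p → count-pos (R? i) (proj₂ (total i p)))
    (λ j _ → count-≤1 (λ i → R? i j) unique) R⊆Q)

-- Read from `j` to `i`, the relation `R` is a partial function defined only on elements of `Q`, and
-- these are too few to reach all of `P`.
pigeonhole : ∀ {m n} {P : Pred (Fin m) 0ℓ} {Q : Pred (Fin n) 0ℓ} {R : Fin m → Fin n → Set}
  (P? : Decidable P) (Q? : Decidable Q) (R? : ∀ i j → Dec (R i j)) →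
  (∀ {i i′ j} → R i j → R i′ j → i ≡ i′) →
  (∀ {i j} → R i j → Q j) →
  count Q? < count P? → ∃ λ i → P i × (∀ j → ¬ R i j)
pigeonhole P? Q? R? unique R⊆Q Q<P with any? (λ i → P? i ×-dec all? (¬? ∘ R? i))
... | yes found = found
... | no none = contradiction
        (injective⇒count≤ P? Q? R? (λ i p → related i p (any? (R? i))) unique R⊆Q) (<⇒≱ Q<P)
  where
  related : ∀ i → _ → Dec (∃ _) → ∃ _
  related i p (yes r) = r
  related i p (no ¬r) = contradiction (i , p , λ j r → ¬r (j , r)) none

-- Greedy choice, each value being removed from `Q`. The map is total, so `default` supplies its
-- values outside `P`.
injection : ∀ {m n} {P : Pred (Fin m) 0ℓ} {Q : Pred (Fin n) 0ℓ}
  (P? : Decidable P) (Q? : Decidable Q) → Fin n → count P? ≤ count Q? →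
  ∃ λ (f : Fin m → Fin n) → (∀ {i} → P i → Q (f i)) ×
                            (∀ {i j} → P i → P j → f i ≡ f j → i ≡ j)
injection {zero} P? Q? default P≤Q = (λ ()) , (λ { {()} }) , λ { {()} }
injection {suc m} {n} {P} {Q} P? Q? default P≤Q with P? zero
... | no ¬p = f′ , (λ { {zero} p → contradiction p ¬p ; {suc i} → f∈Q }) , f-inj′
  where
  rec = injection (P? ∘ suc) Q? default P≤Q
  f = proj₁ rec
  f∈Q = proj₁ (proj₂ rec)
  f-inj = proj₂ (proj₂ rec)
  f′ : Fin (suc m) → Fin n
  f′ zero = default
  f′ (suc i) = f i
  f-inj′ : ∀ {i j} → P i → P j → f′ i ≡ f′ j → i ≡ j
  f-inj′ {zero} p _ _ = contradiction p ¬p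
  f-inj′ {suc i} {zero} _ p _ = contradiction p ¬p
  f-inj′ {suc i} {suc j} p q eq = cong suc (f-inj p q eq)
... | yes _ with count-nonempty Q? (≤-trans (s≤s z≤n) P≤Q)
...   | x , qx = f′ , f∈Q′ , f-inj′
  where
  rec = injection (P? ∘ suc) (Q? -? x) default (≤-pred (≤-trans P≤Q (count-remove Q? x)))
  f = proj₁ rec
  f∈Q = proj₁ (proj₂ rec)
  f-inj = proj₂ (proj₂ rec)
  f′ : Fin (suc m) → Fin n
  f′ zero = x
  f′ (suc i) = f i
  f∈Q′ : ∀ {i} → P i → Q (f′ i)
  f∈Q′ {zero} _ = qx
  f∈Q′ {suc i} p = proj₁ (f∈Q p)
  f-inj′ : ∀ {i j} → P i → P j → f′ i ≡ f′ j → i ≡ j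
  f-inj′ {zero} {zero} _ _ _ = refl
  f-inj′ {zero} {suc j} _ q eq = contradiction (sym eq) (proj₂ (f∈Q q))
  f-inj′ {suc i} {zero} p _ eq = contradiction eq (proj₂ (f∈Q p))
  f-inj′ {suc i} {suc j} p q eq = cong suc (f-inj p q eq)

greatest : {P : Pred ℕ 0ℓ} → Decidable P → ∀ B → (∀ {d} → P d → d ≤ B) → ∃ P →
           ∃ λ D → P D × (∀ {d} → P d → d ≤ D)
greatest P? zero bound (d , p) with bound p
... | z≤n = 0 , p , bound
greatest {P} P? (suc B) bound inhabited with P? (suc B)
... | yes p = suc B , p , bound
... | no ¬p = greatest P? B tighter inhabited
  where
  tighter : ∀ {d} → P d → d ≤ B
  tighter p = ≤-pred (ℕ.≤∧≢⇒< (bound p) λ { refl → ¬p p })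

-- The block of an independent triple

-- `Free` speaks of graphs induced on a `Subset`, so the image of `f` must be written as a vector of
-- booleans; the decidable preimages serve this purpose.
embedding⇒¬Free : ∀ {V n} {H : Graph V} {G : Graph (Fin n)} (f : V → Fin n) →
  (∀ x → Dec (∃ λ v → f v ≡ x)) → (∀ {u v} → f u ≡ f v → u ≡ v) →
  (∀ {u v} → Adj H u v → Adj G (f u) (f v)) →
  (∀ {u v} → Adj G (f u) (f v) → Adj H u v) → ¬ Free H G
embedding⇒¬Free {V} {n} f preimage? f-inj preserves reflects free = free S
  ( mk↔ₛ′ (λ v → f v , ∈S v) from to∘from
      (λ v → f-inj (proj₂ (preimage (f v) (∈S v))))
  , λ u v → mk⇔ preserves reflects )
  where
  S : Subset n
  S = tabulate (does ∘ preimage?)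
  ∈S : ∀ v → f v ∈ S
  ∈S v = lookup⇒[]= (f v) S (trans (lookup∘tabulate _ (f v)) hit)
    where
    hit : does (preimage? (f v)) ≡ true
    hit with preimage? (f v)
    ... | yes _ = refl
    ... | no miss = contradiction (v , refl) miss
  preimage : ∀ x → x ∈ S → ∃ λ v → f v ≡ x
  preimage x x∈S with preimage? x | trans (sym (lookup∘tabulate (does ∘ preimage?) x)) ([]=⇒lookup x∈S)
  ... | yes p | _ = p
  ... | no _ | ()
  from : ∃ (_∈ S) → V
  from (x , x∈S) = proj₁ (preimage x x∈S)
  to∘from : ∀ y → (f (from y) , ∈S (from y)) ≡ y
  to∘from (x , x∈S) = pair-≡ (proj₂ (preimage x x∈S))
    where
    pair-≡ : ∀ {y z} {p : y ∈ S} {q : z ∈ S} → y ≡ z → _≡_ {A = ∃ (_∈ S)} (y , p) (z , q)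
    pair-≡ refl = cong (_ ,_) ([]=-irrelevant _ _)

module _ {n : ℕ} (G : Graph (Fin n)) (free : Free (Path 3 ⊕ Path 1) G) where

  -- Otherwise `d` would be the isolated vertex next to the induced path `a`, `b`, `c`. It differs
  -- from these three because each of them is adjacent to `a` or to `b`.
  no-induced-P₃+P₁ : ∀ {a b c d} → Adj G a b → Adj G b c → a ≢ c → ¬ Adj G a c →
                     ¬ Adj G d a → ¬ Adj G d b → Adj G d c
  no-induced-P₃+P₁ {a} {b} {c} {d} ab bc a≢c ¬ac ¬da ¬db = decidable-stable (adj? G d c) λ ¬dc →
    embedding⇒¬Free {H = Path 3 ⊕ Path 1} {G} f preimage? (f-inj ¬dc) preserves (reflects ¬dc) free
    where
    f : Fin 3 ⊎ Fin 1 → Fin n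
    f (inj₁ 0F) = a
    f (inj₁ 1F) = b
    f (inj₁ 2F) = c
    f (inj₂ 0F) = d
    preimage? : ∀ x → Dec (∃ λ v → f v ≡ x)
    preimage? x with any? (λ i → f (inj₁ i) ≟ x) | any? (λ i → f (inj₂ i) ≟ x)
    ... | yes (i , p) | _ = yes (inj₁ i , p)
    ... | no _ | yes (i , p) = yes (inj₂ i , p)
    ... | no ¬p | no ¬q = no λ { (inj₁ i , p) → ¬p (i , p) ; (inj₂ i , q) → ¬q (i , q) }
    a≢b : a ≢ b
    a≢b refl = irrefl G refl ab
    b≢c : b ≢ c
    b≢c refl = irrefl G refl bc
    d≢a : d ≢ a
    d≢a refl = ¬db ab
    d≢b : d ≢ b
    d≢b refl = ¬da (symm G ab)
    module _ (¬dc : ¬ Adj G d c) where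
      d≢c : d ≢ c
      d≢c refl = ¬db (symm G bc)
      f-inj : ∀ {u v} → f u ≡ f v → u ≡ v
      f-inj {inj₁ 0F} {inj₁ 0F} _ = refl
      f-inj {inj₁ 0F} {inj₁ 1F} eq = contradiction eq a≢b
      f-inj {inj₁ 0F} {inj₁ 2F} eq = contradiction eq a≢c
      f-inj {inj₁ 1F} {inj₁ 0F} eq = contradiction (sym eq) a≢b
      f-inj {inj₁ 1F} {inj₁ 1F} _ = refl
      f-inj {inj₁ 1F} {inj₁ 2F} eq = contradiction eq b≢c
      f-inj {inj₁ 2F} {inj₁ 0F} eq = contradiction (sym eq) a≢c
      f-inj {inj₁ 2F} {inj₁ 1F} eq = contradiction (sym eq) b≢c
      f-inj {inj₁ 2F} {inj₁ 2F} _ = refl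
      f-inj {inj₁ 0F} {inj₂ 0F} eq = contradiction (sym eq) d≢a
      f-inj {inj₁ 1F} {inj₂ 0F} eq = contradiction (sym eq) d≢b
      f-inj {inj₁ 2F} {inj₂ 0F} eq = contradiction (sym eq) d≢c
      f-inj {inj₂ 0F} {inj₁ 0F} eq = contradiction eq d≢a
      f-inj {inj₂ 0F} {inj₁ 1F} eq = contradiction eq d≢b
      f-inj {inj₂ 0F} {inj₁ 2F} eq = contradiction eq d≢c
      f-inj {inj₂ 0F} {inj₂ 0F} _ = refl
      reflects : ∀ {u v} → Adj G (f u) (f v) → Adj (Path 3 ⊕ Path 1) u v
      reflects {inj₁ 0F} {inj₁ 0F} e = contradiction e (irrefl G refl)
      reflects {inj₁ 0F} {inj₁ 1F} e = Pointwise.inj₁ (inj₁ refl)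
      reflects {inj₁ 0F} {inj₁ 2F} e = contradiction e ¬ac
      reflects {inj₁ 1F} {inj₁ 0F} e = Pointwise.inj₁ (inj₂ refl)
      reflects {inj₁ 1F} {inj₁ 1F} e = contradiction e (irrefl G refl)
      reflects {inj₁ 1F} {inj₁ 2F} e = Pointwise.inj₁ (inj₁ refl)
      reflects {inj₁ 2F} {inj₁ 0F} e = contradiction (symm G e) ¬ac
      reflects {inj₁ 2F} {inj₁ 1F} e = Pointwise.inj₁ (inj₂ refl)
      reflects {inj₁ 2F} {inj₁ 2F} e = contradiction e (irrefl G refl)
      reflects {inj₁ 0F} {inj₂ 0F} e = contradiction (symm G e) ¬da
      reflects {inj₁ 1F} {inj₂ 0F} e = contradiction (symm G e) ¬db
      reflects {inj₁ 2F} {inj₂ 0F} e = contradiction (symm G e) ¬dc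
      reflects {inj₂ 0F} {inj₁ 0F} e = contradiction e ¬da
      reflects {inj₂ 0F} {inj₁ 1F} e = contradiction e ¬db
      reflects {inj₂ 0F} {inj₁ 2F} e = contradiction e ¬dc
      reflects {inj₂ 0F} {inj₂ 0F} e = contradiction e (irrefl G refl)
    preserves : ∀ {u v} → Adj (Path 3 ⊕ Path 1) u v → Adj G (f u) (f v)
    preserves {inj₁ 0F} {inj₁ 1F} _ = ab
    preserves {inj₁ 1F} {inj₁ 0F} _ = symm G ab
    preserves {inj₁ 1F} {inj₁ 2F} _ = bc
    preserves {inj₁ 2F} {inj₁ 1F} _ = symm G bc
    preserves {inj₁ 0F} {inj₁ 0F} (Pointwise.inj₁ (inj₁ ()))
    preserves {inj₁ 0F} {inj₁ 0F} (Pointwise.inj₁ (inj₂ ()))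
    preserves {inj₁ 0F} {inj₁ 2F} (Pointwise.inj₁ (inj₁ ()))
    preserves {inj₁ 0F} {inj₁ 2F} (Pointwise.inj₁ (inj₂ ()))
    preserves {inj₁ 2F} {inj₁ 0F} (Pointwise.inj₁ (inj₁ ()))
    preserves {inj₁ 2F} {inj₁ 0F} (Pointwise.inj₁ (inj₂ ()))
    preserves {inj₁ 1F} {inj₁ 1F} (Pointwise.inj₁ (inj₁ ()))
    preserves {inj₁ 1F} {inj₁ 1F} (Pointwise.inj₁ (inj₂ ()))
    preserves {inj₁ 2F} {inj₁ 2F} (Pointwise.inj₁ (inj₁ ()))
    preserves {inj₁ 2F} {inj₁ 2F} (Pointwise.inj₁ (inj₂ ()))
    preserves {inj₂ 0F} {inj₂ 0F} (Pointwise.inj₂ (inj₁ ()))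
    preserves {inj₂ 0F} {inj₂ 0F} (Pointwise.inj₂ (inj₂ ()))

  module Triple (t : Fin 3 → Fin n) (t-distinct : ∀ {i j} → i ≢ j → t i ≢ t j)
                (t-indep : ∀ i j → ¬ Adj G (t i) (t j)) where

    InBlock : Pred (Fin n) 0ℓ
    InBlock v = ∃ λ i → ¬ Adj G v (t i)

    inBlock? : Decidable InBlock
    inBlock? v = any? λ i → ¬? (adj? G v (t i))

    -- The path `t i`, `v`, `t j` is induced, and a `t h` not adjacent to `v` would be isolated from
    -- it. So a block vertex has at most one neighbour in the triple, which is the fact behind
    -- everything below.
    two-neighbours⇒∉Block : ∀ {v i j} → i ≢ j → Adj G v (t i) → Adj G v (t j) → ¬ InBlock v
    two-neighbours⇒∉Block {v} {i} {j} i≢j vi vj (h , ¬vh) = contradiction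
      (no-induced-P₃+P₁ {d = t h} (symm G vi) vj (t-distinct i≢j) (t-indep i j)
        (t-indep h i) (¬vh ∘ symm G))
      (t-indep h j)

    -- A block vertex `x` misses two members `t i` and `t j` of the triple. If it also missed `v`,
    -- it would be isolated from the induced path `t i`, `v`, `t j`.
    Block-complete : ∀ {v x} → ¬ InBlock v → InBlock x → Adj G x v
    Block-complete {v} {x} ¬v∈ x∈@(i , ¬xi) = decidable-stable (adj? G x v) λ ¬xv →
      let j , i≢j , ¬xj = other i ¬xi in
      ¬xj (no-induced-P₃+P₁ (symm G (adj i)) (adj j) (t-distinct i≢j) (t-indep i j) ¬xi ¬xv)
      where
      adj : ∀ i → Adj G v (t i)
      adj i = decidable-stable (adj? G v (t i)) λ ¬vi → ¬v∈ (i , ¬vi)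
      pick : ∀ {i j h} → i ≢ j → i ≢ h → j ≢ h → ∃ λ j → i ≢ j × ¬ Adj G x (t j)
      pick {i} {j} {h} i≢j i≢h j≢h with adj? G x (t j) | adj? G x (t h)
      ... | no ¬xj | _ = j , i≢j , ¬xj
      ... | yes _ | no ¬xh = h , i≢h , ¬xh
      ... | yes xj | yes xh = contradiction x∈ (two-neighbours⇒∉Block j≢h xj xh)
      other : ∀ i → ¬ Adj G x (t i) → ∃ λ j → i ≢ j × ¬ Adj G x (t j)
      other 0F _ = pick {0F} {1F} {2F} (λ ()) (λ ()) (λ ())
      other 1F _ = pick {1F} {0F} {2F} (λ ()) (λ ()) (λ ())
      other 2F _ = pick {2F} {0F} {1F} (λ ()) (λ ()) (λ ())

    -- Each of `x` and `y` has at most one neighbour among the three vertices of the triple, so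
    -- together they cannot cover it.
    common-non-neighbour : ∀ {x y} → InBlock x → InBlock y →
                           ∃ λ i → ¬ Adj G x (t i) × ¬ Adj G y (t i)
    common-non-neighbour {x} {y} x∈ y∈
      with any? (λ i → ¬? (adj? G x (t i)) ×-dec ¬? (adj? G y (t i)))
    ... | yes found = found
    ... | no none = contradiction (pairs (hit 0F) (hit 1F) (hit 2F)) λ ()
      where
      hit : ∀ i → Adj G x (t i) ⊎ Adj G y (t i)
      hit i with adj? G x (t i) | adj? G y (t i)
      ... | yes xi | _ = inj₁ xi
      ... | no _ | yes yi = inj₂ yi
      ... | no ¬xi | no ¬yi = contradiction (i , ¬xi , ¬yi) none
      pairs : Adj G x (t 0F) ⊎ Adj G y (t 0F) → Adj G x (t 1F) ⊎ Adj G y (t 1F) →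
              Adj G x (t 2F) ⊎ Adj G y (t 2F) → ⊥
      pairs (inj₁ a) (inj₁ b) _ = two-neighbours⇒∉Block (λ ()) a b x∈
      pairs (inj₂ a) (inj₂ b) _ = two-neighbours⇒∉Block (λ ()) a b y∈
      pairs (inj₁ a) (inj₂ _) (inj₁ c) = two-neighbours⇒∉Block (λ ()) a c x∈
      pairs (inj₁ _) (inj₂ b) (inj₂ c) = two-neighbours⇒∉Block (λ ()) b c y∈
      pairs (inj₂ _) (inj₁ b) (inj₁ c) = two-neighbours⇒∉Block (λ ()) b c x∈
      pairs (inj₂ a) (inj₁ _) (inj₂ c) = two-neighbours⇒∉Block (λ ()) a c y∈

    -- Suppose that `a`, `b`, `c` is an induced path. Some `t j` misses `b` and `c`, hence sees `a`.
    -- Then `t j`, `a`, `b` is an induced path, and a `t i` that misses `a` and `b` is isolated from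
    -- it.
    Block-P₃-free : ∀ {a b c} → InBlock a → InBlock b → InBlock c →
                    Adj G a b → Adj G b c → a ≢ c → Adj G a c
    Block-P₃-free {a} {b} {c} a∈ b∈ c∈ ab bc a≢c = decidable-stable (adj? G a c) λ ¬ac →
      let i , ¬ai , ¬bi = common-non-neighbour a∈ b∈
          j , ¬bj , ¬cj = common-non-neighbour b∈ c∈
          aj = no-induced-P₃+P₁ (symm G bc) (symm G ab) (≢-sym a≢c) (¬ac ∘ symm G)
                 (¬cj ∘ symm G) (¬bj ∘ symm G)
      in ¬bi (symm G (no-induced-P₃+P₁ {d = t i} aj ab
           (λ tj≡b → ¬cj (subst (Adj G c) (sym tj≡b) (symm G bc))) (¬bj ∘ symm G) (t-indep i j) (¬ai ∘ symm G)))

-- Recolouring along a quotient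

WalkWithin : ∀ {V} → Graph V → ℕ → V → V → Set
WalkWithin G m u v = ∃ λ (p : Walk G u v) → length G p ≤ m

module _ {V : Set} (G : Graph V) where

  length-◅◅ : ∀ {u v w} (p : Walk G u v) (q : Walk G v w) →
              length G (p ◅◅ q) ≡ length G p + length G q
  length-◅◅ ε q = refl
  length-◅◅ (e ◅ p) q = cong suc (length-◅◅ p q)

  within-◅◅ : ∀ {m m′ u v w} → WalkWithin G m u v → WalkWithin G m′ v w → WalkWithin G (m + m′) u w
  within-◅◅ (p , p≤) (q , q≤) = p ◅◅ q , ≤-trans (≤-reflexive (length-◅◅ p q)) (+-mono-≤ p≤ q≤)

  within-mono : ∀ {m m′ u v} → m ≤ m′ → WalkWithin G m u v → WalkWithin G m′ u v
  within-mono m≤ (p , p≤) = p , ≤-trans p≤ m≤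

  within-reverse : ∀ {m u v} → WalkWithin G m u v → WalkWithin G m v u
  within-reverse (p , p≤) = proj₁ (go p) , ≤-trans (proj₂ (go p)) p≤
    where
    go : ∀ {u v} (p : Walk G u v) → WalkWithin G (length G p) v u
    go ε = ε , z≤n
    go (e ◅ p) = within-mono (≤-reflexive (ℕ.+-comm _ 1)) (within-◅◅ (go p) (symm G e ◅ ε , s≤s z≤n))

module _ {ℓ n : ℕ} {G : Graph (Fin n)} where

  -- Properness is stored irrelevantly; being decidable, it can be recomputed.
  colour-proper : (α : Colouring ℓ G) → ∀ {u v} → Adj G u v → colour α u ≢ colour α v
  colour-proper (colouring xs p) {u} {v} = recompute (proper? G xs) p u v

  colour-injective : {α β : Colouring ℓ G} → (∀ v → colour α v ≡ colour β v) → α ≡ β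
  colour-injective {colouring xs _} {colouring ys _} eq = go
    (trans (sym (tabulate∘lookup xs)) (trans (tabulate-cong eq) (tabulate∘lookup ys)))
    where
    go : ∀ {xs ys} .{p : Proper G xs} .{q : Proper G ys} → xs ≡ ys → colouring {G = G} xs p ≡ colouring ys q
    go refl = refl

  recolour-vertex : (α : Colouring ℓ G) (v : Fin n) (c : Fin ℓ) → c ≢ colour α v →
    (∀ u → Adj G u v → colour α u ≢ c) →
    ∃ λ (β : Colouring ℓ G) → Adj (𝓡 ℓ G) α β × colour β v ≡ c ×
                              (∀ {u} → u ≢ v → colour β u ≡ colour α u)
  recolour-vertex α v c c≢ ok =
    colouring (colours α ⟨ v ⟩≔ c) proper′
    , (v , (λ eq → c≢ (sym (trans eq at-v))) , λ {w} → unique w)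
    , at-v , off-v
    where
    at-v : lookup (colours α ⟨ v ⟩≔ c) v ≡ c
    at-v = lookup∘update v (colours α) c
    off-v : ∀ {u} → u ≢ v → lookup (colours α ⟨ v ⟩≔ c) u ≡ colour α u
    off-v u≢v = lookup∘update′ u≢v (colours α) c
    proper′ : Proper G (colours α ⟨ v ⟩≔ c)
    proper′ x y e eq with x ≟ v | y ≟ v
    ... | yes refl | yes refl = irrefl G refl e
    ... | yes refl | no y≢v = ok y (symm G e) (trans (sym (off-v y≢v)) (trans (sym eq) at-v))
    ... | no x≢v | yes refl = ok x e (trans (sym (off-v x≢v)) (trans eq at-v))
    ... | no x≢v | no y≢v = colour-proper α e (trans (sym (off-v x≢v)) (trans eq (off-v y≢v)))
    unique : ∀ w → colour α w ≢ lookup (colours α ⟨ v ⟩≔ c) w → v ≡ w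
    unique w d = sym (decidable-stable (w ≟ v) λ w≢v → d (sym (off-v w≢v)))

  -- No vertex is given a colour that a neighbour has now or will have later,
  -- so the vertices can be recoloured one by one in any order.
  recolour-compatible : (α : Colouring ℓ G) (f : Fin n → Fin ℓ) →
    (∀ u v → Adj G u v → f u ≢ f v) → (∀ u v → Adj G u v → colour α u ≢ f v) →
    ∃ λ (β : Colouring ℓ G) → (∀ v → colour β v ≡ f v) ×
      WalkWithin (𝓡 ℓ G) (count (λ v → ¬? (colour α v ≟ f v))) α β
  recolour-compatible α f f-proper = go n α (count-≤n (λ v → ¬? (colour α v ≟ f v)))
    where
    go : ∀ N α → count (λ v → ¬? (colour α v ≟ f v)) ≤ N → (∀ u v → Adj G u v → colour α u ≢ f v) →
         ∃ λ β → (∀ v → colour β v ≡ f v) ×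
           WalkWithin (𝓡 ℓ G) (count (λ v → ¬? (colour α v ≟ f v))) α β
    go N α ≤N compatible with any? (λ v → ¬? (colour α v ≟ f v))
    ... | no none = α , (λ v → decidable-stable (colour α v ≟ f v) λ d → none (v , d)) , ε , z≤n
    go zero α ≤N compatible | yes (v , d) =
      contradiction (≤-trans (count-pos (λ v → ¬? (colour α v ≟ f v)) d) ≤N) λ ()
    go (suc N) α ≤N compatible | yes (v , d) with recolour-vertex α v (f v) (≢-sym d) (λ u e → compatible u v e)
    ... | α₁ , step , at-v , off-v =
      let fewer = count-< (λ v → ¬? (colour α₁ v ≟ f v)) (λ v → ¬? (colour α v ≟ f v))
                    {v} subset (λ d → d at-v) d
          β , β≡f , walk = go N α₁ (≤-pred (≤-trans fewer ≤N)) compatible₁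
      in β , β≡f , within-mono (𝓡 ℓ G) fewer (within-◅◅ (𝓡 ℓ G) (step ◅ ε , ≤-refl) walk)
      where
      subset : ∀ {u} → colour α₁ u ≢ f u → colour α u ≢ f u
      subset {u} d₁ eq with u ≟ v
      ... | yes refl = d₁ at-v
      ... | no u≢v = d₁ (trans (off-v u≢v) eq)
      -- The vertex just recoloured has its final colour, where properness of `f` takes over.
      compatible₁ : ∀ u w → Adj G u w → colour α₁ u ≢ f w
      compatible₁ u w e eq with u ≟ v
      ... | yes refl = f-proper u w e (trans (sym at-v) eq)
      ... | no u≢v = compatible u w e (trans (sym (off-v u≢v)) eq)

-- For colourings constant on the fibres of `q`, given by maps on `H`. A move recolours a whole
-- fibre at the cost of its size. With `q` the identity this treats single vertices; with `H`
-- complete on the classes of γ it exchanges the colours of whole classes.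
module Quotient {ℓ n m : ℕ} {G : Graph (Fin n)} (H : Graph (Fin m)) (q : Fin n → Fin m)
  (q-hom : ∀ {u v} → Adj G u v → Adj H (q u) (q v)) where

  ProperMap : (Fin m → Fin ℓ) → Set
  ProperMap a = ∀ {x y} → Adj H x y → a x ≢ a y

  fibre? : ∀ x → Decidable (λ v → q v ≡ x)
  fibre? x v = q v ≟ x

  recolour-fibre : (a : Fin m → Fin ℓ) → ProperMap a → (α : Colouring ℓ G) →
    (∀ v → colour α v ≡ a (q v)) → ∀ x c → (∀ y → Adj H y x → a y ≢ c) →
    let a′ = updateAt a x (const c) in
    ProperMap a′ × ∃ λ (β : Colouring ℓ G) → (∀ v → colour β v ≡ a′ (q v)) ×
                     WalkWithin (𝓡 ℓ G) (count (fibre? x)) α β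
  recolour-fibre a a-proper α α≡a x c free =
    a′-proper , β , β≡ , within-mono (𝓡 ℓ G)
      (count-mono (λ v → ¬? (colour α v ≟ a′ (q v))) (fibre? x) λ {v} → changed v) walk
    where
    a′ = updateAt a x (const c)
    at-x : a′ x ≡ c
    at-x = updateAt-updates x a
    off-x : ∀ {y} → y ≢ x → a′ y ≡ a y
    off-x {y} y≢x = updateAt-minimal y x a y≢x
    compatible : ∀ {y z} → Adj H y z → a y ≢ a′ z
    compatible {y} {z} e eq with z ≟ x
    ... | yes refl = free y e (trans eq at-x)
    ... | no z≢x = a-proper e (trans eq (off-x z≢x))
    a′-proper : ProperMap a′
    a′-proper {y} {z} e eq with y ≟ x
    ... | no y≢x = compatible e (trans (sym (off-x y≢x)) eq)
    ... | yes refl with z ≟ x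
    ...   | yes refl = irrefl H refl e
    ...   | no z≢x = free z (symm H e) (trans (sym (off-x z≢x)) (trans (sym eq) at-x))
    changed : ∀ v → colour α v ≢ a′ (q v) → q v ≡ x
    changed v d = decidable-stable (q v ≟ x) λ qv≢x → d (trans (α≡a v) (sym (off-x qv≢x)))
    result = recolour-compatible α (a′ ∘ q) (λ u v e → a′-proper (q-hom e))
               (λ u v e eq → compatible (q-hom e) (trans (sym (α≡a u)) eq))
    β = proj₁ result
    β≡ = proj₁ (proj₂ result)
    walk = proj₂ (proj₂ result)

  -- `M` marks what may move. By `P₃-free` it induces a disjoint union of cliques, and `spare`
  -- provides the colours for evictions. The latter is asked of every `a` that agrees with `b`
  -- outside `M`, since it is applied to intermediate maps.
  module _ (b : Fin m → Fin ℓ) (b-proper : ProperMap b) {M : Pred (Fin m) 0ℓ} (M? : Decidable M)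
    (P₃-free : ∀ {x y z} → M x → M y → M z → Adj H x y → Adj H y z → x ≢ z → Adj H x z)
    (spare : ∀ a → ProperMap a → (∀ {x} → ¬ M x → a x ≡ b x) → ∀ {x} → M x →
             ∃ λ c → c ≢ a x × (∀ y → Adj H y x → a y ≢ c)) where

    -- A predicate on vertices of `G` rather than `H`, so that counting weighs each wrong fibre by
    -- its size and disregards empty ones.
    Wrong : (Fin m → Fin ℓ) → Pred (Fin n) 0ℓ
    Wrong a v = a (q v) ≢ b (q v)

    wrong? : ∀ a → Decidable (Wrong a)
    wrong? a v = ¬? (a (q v) ≟ b (q v))

    size : Fin m → ℕ
    size x = count (fibre? x)

    heaviest-wrong : ∀ a → ∃ (Wrong a) →
      ∃ λ v → Wrong a v × (∀ {u} → Wrong a u → size (q u) ≤ size (q v))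
    heaviest-wrong a (v , w) with greatest
      (λ d → any? λ v → wrong? a v ×-dec (size (q v) ℕ.≟ d)) n
      (λ { (v , _ , refl) → count-≤n (fibre? (q v)) }) (size (q v) , v , w , refl)
    ... | _ , (v , w , refl) , max = v , w , λ {u} w → max (u , w , refl)

    -- A heaviest wrong fibre is moved to its target, after evicting its only
    -- possible blocker, which is wrong itself and hence no heavier.
    recolour-quotient : ∀ N a → count (wrong? a) ≤ N → (α : Colouring ℓ G) →
      (∀ v → colour α v ≡ a (q v)) → ProperMap a → (∀ {x} → ¬ M x → a x ≡ b x) →
      ∃ λ (β : Colouring ℓ G) → (∀ v → colour β v ≡ b (q v)) ×
        WalkWithin (𝓡 ℓ G) (2 * count (wrong? a)) α β
    recolour-quotient N a ≤N α α≡a a-proper a≡b with any? (wrong? a)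
    ... | no none = α , (λ v → trans (α≡a v) (decidable-stable (a (q v) ≟ b (q v)) λ d → none (v , d)))
                  , ε , z≤n
    recolour-quotient zero a ≤N α α≡a a-proper a≡b | yes (v , w) =
      contradiction (≤-trans (count-pos (wrong? a) w) ≤N) λ ()
    recolour-quotient (suc N) a ≤N α α≡a a-proper a≡b | yes inhabited
      with heaviest-wrong a inhabited
    ... | v , w , heaviest = by-blocker (any? λ y → adj? H y x ×-dec (a y ≟ b x))
      where
      x = q v
      Goal = ∃ λ (β : Colouring ℓ G) → (∀ v → colour β v ≡ b (q v)) ×
               WalkWithin (𝓡 ℓ G) (2 * count (wrong? a)) α β

      M-wrong : ∀ {y} → a y ≢ b y → M y
      M-wrong {y} d = decidable-stable (M? y) λ ¬My → d (a≡b ¬My)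

      0<size : 1 ≤ size x
      0<size = count-pos (fibre? x) refl

      -- `a₁` is the situation after a possible eviction: nothing that was right has been spoilt,
      -- and `x` can now take its target colour.
      finish : ∀ a₁ → ProperMap a₁ → (∀ {z} → ¬ M z → a₁ z ≡ b z) →
        (∀ {z} → a z ≡ b z → a₁ z ≡ b z) → (∀ y → Adj H y x → a₁ y ≢ b x) →
        ∀ {α₁} → (∀ v → colour α₁ v ≡ a₁ (q v)) →
        WalkWithin (𝓡 ℓ G) (size x) α α₁ → Goal
      finish a₁ a₁-proper a₁≡b keeps unblocked {α₁} α₁≡a₁ walk₁ =
        let a₂-proper , α₂ , α₂≡a₂ , walk₂ = recolour-fibre a₁ a₁-proper α₁ α₁≡a₁ x (b x) unblocked
            β , β≡b , walk₃ = recolour-quotient N a₂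
              (≤-pred (≤-trans (+-monoˡ-≤ _ 0<size) (≤-trans fewer ≤N)))
              α₂ α₂≡a₂ a₂-proper a₂≡b
        in β , β≡b , within-mono (𝓡 ℓ G) bound
             (within-◅◅ (𝓡 ℓ G) walk₁ (within-◅◅ (𝓡 ℓ G) walk₂ walk₃))
        where
        a₂ = updateAt a₁ x (const (b x))
        right : ∀ {z} → z ≡ x ⊎ a₁ z ≡ b z → a₂ z ≡ b z
        right (inj₁ refl) = updateAt-updates x a₁
        right {z} (inj₂ eq) with z ≟ x
        ... | yes refl = updateAt-updates x a₁
        ... | no z≢x = trans (updateAt-minimal z x a₁ z≢x) eq
        a₂≡b : ∀ {z} → ¬ M z → a₂ z ≡ b z
        a₂≡b ¬Mz = right (inj₂ (a₁≡b ¬Mz))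
        fewer : size x + count (wrong? a₂) ≤ count (wrong? a)
        fewer = count-disjoint (fibre? x) (wrong? a₂) (wrong? a)
          (λ qu≡x wrong₂ → wrong₂ (right (inj₁ qu≡x)))
          (λ qu≡x → subst (λ y → a y ≢ b y) (sym qu≡x) w)
          (λ wrong₂ eq → wrong₂ (right (inj₂ (keeps eq))))
        -- The eviction and the move cost at most `size x` each, and the `size x` vertices over `x`
        -- have become right for good. Hence the factor 2.
        bound : size x + (size x + 2 * count (wrong? a₂)) ≤ 2 * count (wrong? a)
        bound = begin
          size x + (size x + 2 * count (wrong? a₂)) ≡⟨ sym (+-assoc (size x) _ _) ⟩
          size x + size x + 2 * count (wrong? a₂)
            ≡⟨ cong (λ k → size x + k + 2 * count (wrong? a₂)) (sym (+-identityʳ (size x))) ⟩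
          2 * size x + 2 * count (wrong? a₂) ≡⟨ sym (*-distribˡ-+ 2 (size x) _) ⟩
          2 * (size x + count (wrong? a₂)) ≤⟨ *-monoʳ-≤ 2 fewer ⟩
          2 * count (wrong? a) ∎
          where open ≤-Reasoning

      by-blocker : Dec (∃ λ y → Adj H y x × a y ≡ b x) → Goal
      by-blocker (no none) = finish a a-proper a≡b (λ eq → eq) (λ y e eq → none (y , e , eq))
                               α≡a (ε , z≤n)
      by-blocker (yes (y , yx , ay≡bx)) =
        let s , s≢ay , s-free = spare a a-proper a≡b My
            a₁-proper , α₁ , α₁≡a₁ , walk = recolour-fibre a a-proper α α≡a y s s-free
        in finish (updateAt a y (const s)) a₁-proper
             (λ {z} ¬Mz → trans (updateAt-minimal z y a (λ { refl → ¬Mz My })) (a≡b ¬Mz))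
             (λ {z} eq → trans (updateAt-minimal z y a (λ { refl → wrong-y eq })) eq)
             (unblocked s s≢ay)
             α₁≡a₁ (within-mono (𝓡 ℓ G) lighter walk)
        where
        wrong-y : a y ≢ b y
        wrong-y eq = b-proper yx (trans (sym eq) ay≡bx)
        My = M-wrong wrong-y
        -- The maximality of `x` concerns only nonempty fibres; an empty one has size 0.
        lighter : size y ≤ size x
        lighter with any? (fibre? y)
        ... | yes (u , refl) = heaviest wrong-y
        ... | no none = ≮⇒≥ λ lt → none (count-nonempty (fibre? y) (≤-trans (s≤s z≤n) lt))
        unblocked : ∀ s → s ≢ a y → ∀ z → Adj H z x → updateAt a y (const s) z ≢ b x
        unblocked s s≢ay z zx eq with z ≟ y
        ... | yes refl = s≢ay (trans (sym (updateAt-updates y a)) (trans eq (sym ay≡bx)))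
        -- A second blocker `z` would be wrong too, so by `P₃-free` it would be adjacent to `y`,
        -- although both have the colour `b x`.
        ... | no z≢y = a-proper
              (P₃-free (M-wrong λ az≡bz → b-proper zx (trans (sym az≡bz) az≡bx))
                       (M-wrong w) My zx (symm H yx) z≢y)
              (trans az≡bx (sym ay≡bx))
          where
          az≡bx = trans (sym (updateAt-minimal z y a z≢y)) eq

-- Unifying a colouring with γ

choose : ∀ {A B : Set} → Dec A → B → B → B
choose (yes _) x y = x
choose (no _) x y = y

choose-yes : ∀ {A B : Set} (d : Dec A) {x y : B} → A → choose d x y ≡ x
choose-yes (yes _) a = refl
choose-yes (no ¬a) a = contradiction a ¬a

choose-no : ∀ {A B : Set} (d : Dec A) {x y : B} → ¬ A → choose d x y ≡ y
choose-no (yes a) ¬a = contradiction a ¬a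
choose-no (no _) ¬a = refl

module Unify {ℓ k n : ℕ} {G : Graph (Fin n)} (γ : Fin n → Fin k)
  (γ-proper : ∀ {u v} → Adj G u v → γ u ≢ γ v) where

  -- The budget counts only vertices in the classes of `Γ`, and all others keep their colours; thus
  -- solutions for disjoint sets of classes can be run one after the other and their costs add up.
  record Solution (α : Colouring ℓ G) {Γ : Pred (Fin k) 0ℓ} (Γ? : Decidable Γ)
                  (P : Pred (Fin ℓ) 0ℓ) : Set where
    field
      ι      : Fin k → Fin ℓ
      ι∈P    : ∀ {c} → Γ c → P (ι c)
      ι-inj  : ∀ {c d} → Γ c → Γ d → ι c ≡ ι d → c ≡ d
      result : Colouring ℓ G
      on     : ∀ {v} → Γ (γ v) → colour result v ≡ ι (γ v)
      off    : ∀ {v} → ¬ Γ (γ v) → colour result v ≡ colour α v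
      walk   : WalkWithin (𝓡 ℓ G) (2 * count (Γ? ∘ γ)) α result

  -- The palette must not occur outside `Γ`, but colours outside the palette may occur inside; they
  -- are abandoned on the way. Quantifying over `α` and `P` allows a part to be solved after another
  -- has been recoloured.
  Solvable : {Γ : Pred (Fin k) 0ℓ} → Decidable Γ → Set₁
  Solvable {Γ} Γ? = ∀ (α : Colouring ℓ G) {P : Pred (Fin ℓ) 0ℓ} (P? : Decidable P) →
    (∀ {v} → P (colour α v) → Γ (γ v)) → count Γ? < count P? → Solution α Γ? P

  module _ {Γ Γ₁ Γ₂ : Pred (Fin k) 0ℓ}
    (Γ? : Decidable Γ) (Γ₁? : Decidable Γ₁) (Γ₂? : Decidable Γ₂)
    (Γ₁⊆Γ : ∀ {c} → Γ₁ c → Γ c) (Γ₂⊆Γ : ∀ {c} → Γ₂ c → Γ c)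
    (Γ⊆Γ₁∪Γ₂ : ∀ {c} → Γ c → Γ₁ c ⊎ Γ₂ c) (Γ₁∩Γ₂=∅ : ∀ {c} → Γ₁ c → ¬ Γ₂ c) where

    -- The first part ends up using only |Γ₁| colours, so every other colour of
    -- the palette, including those released on the way, is left for the rest.
    compose : ∀ (α : Colouring ℓ G) {P P₁ : Pred (Fin ℓ) 0ℓ} (P? : Decidable P) →
      (∀ {p} → P₁ p → P p) → (∀ {v} → P (colour α v) → Γ (γ v)) → count Γ? < count P? →
      Solution α Γ₁? P₁ → Solvable Γ₂? → Solution α Γ? P
    compose α {P} {P₁} P? P₁⊆P P→Γ surplus s₁ solvable₂ = record
      { ι = ι
      ; ι∈P = ι∈P
      ; ι-inj = ι-inj
      ; result = S₂.result
      ; on = on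
      ; off = λ ¬Γv → trans (S₂.off (¬Γv ∘ Γ₂⊆Γ)) (S₁.off (¬Γv ∘ Γ₁⊆Γ))
      ; walk = within-mono (𝓡 ℓ G) cost (within-◅◅ (𝓡 ℓ G) S₁.walk S₂.walk)
      }
      where
      module S₁ = Solution s₁
      Used : Pred (Fin ℓ) 0ℓ
      Used p = ∃ λ c → Γ₁ c × S₁.ι c ≡ p
      used? : Decidable Used
      used? p = any? λ c → Γ₁? c ×-dec (S₁.ι c ≟ p)
      P₂ : Pred (Fin ℓ) 0ℓ
      P₂ p = P p × ¬ Used p
      P₂? : Decidable P₂
      P₂? p = P? p ×-dec ¬? (used? p)

      P₂→Γ₂ : ∀ {v} → P₂ (colour S₁.result v) → Γ₂ (γ v)
      P₂→Γ₂ {v} (p , unused) with Γ₁? (γ v)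
      ... | yes g₁ = contradiction (γ v , g₁ , sym (S₁.on g₁)) unused
      ... | no ¬g₁ with Γ⊆Γ₁∪Γ₂ (P→Γ (subst P (S₁.off ¬g₁) p))
      ...   | inj₁ g₁ = contradiction g₁ ¬g₁
      ...   | inj₂ g₂ = g₂

      used≤ : count used? ≤ count Γ₁?
      used≤ = injective⇒count≤ used? Γ₁? (λ p c → Γ₁? c ×-dec (S₁.ι c ≟ p)) (λ p u → u)
        (λ { (_ , refl) (_ , refl) → refl }) proj₁

      surplus₂ : count Γ₂? < count P₂?
      surplus₂ = ℕ.+-cancelˡ-≤ (count Γ₁?) _ _ (begin
        count Γ₁? + suc (count Γ₂?)  ≡⟨ ℕ.+-suc (count Γ₁?) _ ⟩
        suc (count Γ₁? + count Γ₂?)  ≤⟨ s≤s (count-disjoint Γ₁? Γ₂? Γ? Γ₁∩Γ₂=∅ Γ₁⊆Γ Γ₂⊆Γ) ⟩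
        suc (count Γ?)               ≤⟨ surplus ⟩
        count P?                     ≤⟨ count-cover used? P₂? P? split ⟩
        count used? + count P₂?      ≤⟨ +-monoˡ-≤ _ used≤ ⟩
        count Γ₁? + count P₂?        ∎)
        where
        open ≤-Reasoning
        split : ∀ {p} → P p → Used p ⊎ P₂ p
        split {p} pp with used? p
        ... | yes u = inj₁ u
        ... | no ¬u = inj₂ (pp , ¬u)

      s₂ : Solution S₁.result Γ₂? P₂
      s₂ = solvable₂ S₁.result P₂? P₂→Γ₂ surplus₂
      module S₂ = Solution s₂

      ι : Fin k → Fin ℓ
      ι c = choose (Γ₁? c) (S₁.ι c) (S₂.ι c)
      ι₁ : ∀ {c} → Γ₁ c → ι c ≡ S₁.ι c
      ι₁ {c} = choose-yes (Γ₁? c)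
      ι₂ : ∀ {c} → Γ₂ c → ι c ≡ S₂.ι c
      ι₂ {c} g₂ = choose-no (Γ₁? c) λ g₁ → Γ₁∩Γ₂=∅ g₁ g₂

      ι∈P : ∀ {c} → Γ c → P (ι c)
      ι∈P g with Γ⊆Γ₁∪Γ₂ g
      ... | inj₁ g₁ = subst P (sym (ι₁ g₁)) (P₁⊆P (S₁.ι∈P g₁))
      ... | inj₂ g₂ = subst P (sym (ι₂ g₂)) (proj₁ (S₂.ι∈P g₂))

      ι-inj : ∀ {c d} → Γ c → Γ d → ι c ≡ ι d → c ≡ d
      ι-inj {c} {d} gc gd eq with Γ⊆Γ₁∪Γ₂ gc | Γ⊆Γ₁∪Γ₂ gd
      ... | inj₁ g | inj₁ h = S₁.ι-inj g h (trans (sym (ι₁ g)) (trans eq (ι₁ h)))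
      ... | inj₂ g | inj₂ h = S₂.ι-inj g h (trans (sym (ι₂ g)) (trans eq (ι₂ h)))
      ... | inj₁ g | inj₂ h = contradiction
        (c , g , trans (sym (ι₁ g)) (trans eq (ι₂ h))) (proj₂ (S₂.ι∈P h))
      ... | inj₂ g | inj₁ h = contradiction
        (d , h , trans (sym (ι₁ h)) (trans (sym eq) (ι₂ g))) (proj₂ (S₂.ι∈P g))

      on : ∀ {v} → Γ (γ v) → colour S₂.result v ≡ ι (γ v)
      on g with Γ⊆Γ₁∪Γ₂ g
      ... | inj₁ g₁ = trans (S₂.off (Γ₁∩Γ₂=∅ g₁)) (trans (S₁.on g₁) (sym (ι₁ g₁)))
      ... | inj₂ g₂ = trans (S₂.on g₂) (sym (ι₂ g₂))

      cost : 2 * count (Γ₁? ∘ γ) + 2 * count (Γ₂? ∘ γ) ≤ 2 * count (Γ? ∘ γ)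
      cost = ≤-trans (≤-reflexive (sym (*-distribˡ-+ 2 (count (Γ₁? ∘ γ)) _)))
        (*-monoʳ-≤ 2 (count-disjoint (Γ₁? ∘ γ) (Γ₂? ∘ γ) (Γ? ∘ γ) Γ₁∩Γ₂=∅ Γ₁⊆Γ Γ₂⊆Γ))

  -- All vertices coloured `p` lie in the independent class `c`, so no vertex of the class has a
  -- neighbour coloured `p`, and one recolouring per vertex is enough.
  single-class : (α : Colouring ℓ G) (c : Fin k) (p : Fin ℓ) →
                 (∀ v → colour α v ≡ p → γ v ≡ c) → Solution α (_≟ c) (_≡ p)
  single-class α c p p→c = record
    { ι = const p
    ; ι∈P = λ _ → refl
    ; ι-inj = λ { refl refl _ → refl }
    ; result = proj₁ recoloured
    ; on = λ {v} g → trans (proj₁ (proj₂ recoloured) v) (f-on g)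
    ; off = λ {v} ¬g → trans (proj₁ (proj₂ recoloured) v) (f-off ¬g)
    ; walk = within-mono (𝓡 ℓ G) (≤-trans fewer (m≤m+n _ _)) (proj₂ (proj₂ recoloured))
    }
    where
    f : Fin n → Fin ℓ
    f v = choose (γ v ≟ c) p (colour α v)
    f-on : ∀ {v} → γ v ≡ c → f v ≡ p
    f-on {v} = choose-yes (γ v ≟ c)
    f-off : ∀ {v} → γ v ≢ c → f v ≡ colour α v
    f-off {v} = choose-no (γ v ≟ c)
    compatible : ∀ u v → Adj G u v → colour α u ≢ f v
    compatible u v e eq with γ v ≟ c
    ... | yes refl = γ-proper e (p→c u eq)
    ... | no _ = colour-proper α e eq
    f-proper : ∀ u v → Adj G u v → f u ≢ f v
    f-proper u v e eq with γ u ≟ c | γ v ≟ c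
    ... | yes refl | yes γv≡ = γ-proper e (sym γv≡)
    ... | yes refl | no γv≢ = γv≢ (p→c v (sym eq))
    ... | no γu≢ | yes _ = γu≢ (p→c u eq)
    ... | no _ | no _ = colour-proper α e eq
    recoloured = recolour-compatible α f f-proper compatible
    fewer : count (λ v → ¬? (colour α v ≟ f v)) ≤ count (λ v → γ v ≟ c)
    fewer = count-mono (λ v → ¬? (colour α v ≟ f v)) (λ v → γ v ≟ c) λ {v} d →
      decidable-stable (γ v ≟ c) λ γv≢c → d (sym (f-off γv≢c))

  -- The target gives the classes of `Γ` distinct palette colours and leaves the rest alone. It is
  -- proper because the palette does not occur outside `Γ`.
  clusters-solvable : {Γ : Pred (Fin k) 0ℓ} (Γ? : Decidable Γ) →
    (∀ {x y z} → Γ (γ x) → Γ (γ y) → Γ (γ z) → Adj G x y → Adj G y z → x ≢ z → Adj G x z) →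
    Solvable Γ?
  clusters-solvable {Γ} Γ? P₃-free α {P} P? P→Γ surplus = record
    { ι = ι
    ; ι∈P = ι∈P
    ; ι-inj = ι-inj
    ; result = proj₁ recoloured
    ; on = λ {v} g → trans (proj₁ (proj₂ recoloured) v) (b-on g)
    ; off = λ {v} ¬g → trans (proj₁ (proj₂ recoloured) v) (b-off ¬g)
    ; walk = within-mono (𝓡 ℓ G) (*-monoʳ-≤ 2 fewer) (proj₂ (proj₂ recoloured))
    }
    where
    embedding = injection Γ? P? (proj₁ (count-nonempty P? (≤-trans (s≤s z≤n) surplus))) (<⇒≤ surplus)
    ι = proj₁ embedding
    ι∈P : ∀ {c} → Γ c → P (ι c)
    ι∈P = proj₁ (proj₂ embedding)
    ι-inj : ∀ {c d} → Γ c → Γ d → ι c ≡ ι d → c ≡ d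
    ι-inj = proj₂ (proj₂ embedding)
    b : Fin n → Fin ℓ
    b v = choose (Γ? (γ v)) (ι (γ v)) (colour α v)
    b-on : ∀ {v} → Γ (γ v) → b v ≡ ι (γ v)
    b-on {v} = choose-yes (Γ? (γ v))
    b-off : ∀ {v} → ¬ Γ (γ v) → b v ≡ colour α v
    b-off {v} = choose-no (Γ? (γ v))
    b-proper : ∀ {u v} → Adj G u v → b u ≢ b v
    b-proper {u} {v} e eq with Γ? (γ u) | Γ? (γ v)
    ... | yes g | yes h = γ-proper e (ι-inj g h eq)
    ... | yes g | no ¬h = ¬h (P→Γ (subst P eq (ι∈P g)))
    ... | no ¬g | yes h = ¬g (P→Γ (subst P (sym eq) (ι∈P h)))
    ... | no _ | no _ = colour-proper α e eq

    module Q = Quotient {ℓ} {G = G} G id id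

    -- The closed neighbourhood of `x` within `Γ` is a clique, so it has at most one vertex per
    -- class and fewer vertices than there are palette colours. Neighbours outside `Γ` still have
    -- their colours under `α`, none of them in the palette.
    spare : ∀ a → Q.ProperMap a → (∀ {x} → ¬ Γ (γ x) → a x ≡ b x) → ∀ {x} → Γ (γ x) →
            ∃ λ c → c ≢ a x × (∀ y → Adj G y x → a y ≢ c)
    spare a a-proper a≡b {x} gx =
      let p , pp , free = pigeonhole P? Γ? near? near-unique (λ { (_ , _ , g , _ , refl) → g }) surplus
      in p
       , (λ p≡ → free (γ x) (x , inj₁ refl , gx , sym p≡ , refl))
       , λ y yx ay≡p → free (γ y) (y , inj₂ yx , Γ-coloured pp y ay≡p , ay≡p , refl)
      where
      Near : Fin ℓ → Fin k → Set
      Near p c = ∃ λ y → (y ≡ x ⊎ Adj G y x) × Γ (γ y) × a y ≡ p × γ y ≡ c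
      near? : ∀ p c → Dec (Near p c)
      near? p c = any? λ y → (y ≟ x ⊎-dec adj? G y x) ×-dec Γ? (γ y) ×-dec (a y ≟ p) ×-dec (γ y ≟ c)
      Γ-coloured : ∀ {p} → P p → ∀ y → a y ≡ p → Γ (γ y)
      Γ-coloured pp y refl = decidable-stable (Γ? (γ y)) λ ¬g →
        ¬g (P→Γ (subst P (trans (a≡b ¬g) (b-off ¬g)) pp))
      near-adj : ∀ {y z} → y ≡ x ⊎ Adj G y x → z ≡ x ⊎ Adj G z x → Γ (γ y) → Γ (γ z) → y ≢ z → Adj G y z
      near-adj (inj₁ refl) (inj₁ refl) _ _ y≢z = contradiction refl y≢z
      near-adj (inj₁ refl) (inj₂ zx) _ _ _ = symm G zx
      near-adj (inj₂ yx) (inj₁ refl) _ _ _ = yx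
      near-adj (inj₂ yx) (inj₂ zx) gy gz y≢z = P₃-free gy gx gz yx (symm G zx) y≢z
      near-unique : ∀ {p p′ c} → Near p c → Near p′ c → p ≡ p′
      near-unique (y , ny , gy , refl , γy) (z , nz , gz , refl , γz) = cong a
        (decidable-stable (y ≟ z) λ y≢z →
          γ-proper (near-adj ny nz gy gz y≢z) (trans γy (sym γz)))

    recoloured = Q.recolour-quotient b b-proper (Γ? ∘ γ) P₃-free spare n (colour α)
      (count-≤n (λ v → ¬? (colour α v ≟ b v))) α (λ _ → refl) (colour-proper α) (sym ∘ b-off)

    fewer : count (λ v → ¬? (colour α v ≟ b v)) ≤ count (Γ? ∘ γ)
    fewer = count-mono (λ v → ¬? (colour α v ≟ b v)) (Γ? ∘ γ) λ {v} d →
      decidable-stable (Γ? (γ v)) λ ¬g → d (sym (b-off ¬g))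

  module _ {Γ : Pred (Fin k) 0ℓ} (Γ? : Decidable Γ) (α : Colouring ℓ G)
    {P : Pred (Fin ℓ) 0ℓ} (P? : Decidable P) (P→Γ : ∀ {v} → P (colour α v) → Γ (γ v))
    (surplus : count Γ? < count P?) where

    Private : Fin k → Fin ℓ → Set
    Private c p = Γ c × P p × (∀ v → colour α v ≡ p → γ v ≡ c)

    private? : ∀ c p → Dec (Private c p)
    private? c p = Γ? c ×-dec P? p ×-dec all? λ v → (colour α v ≟ p) →-dec (γ v ≟ c)

    -- Every colour of the palette occurs at least twice, so the classes of γ
    -- have more than two vertices on average.
    large-class : ∃ Γ → (∀ c p → ¬ Private c p) → ∃ λ c → Γ c × 3 ≤ count (λ v → γ v ≟ c)
    large-class (c₀ , g₀) none with any? (λ c → Γ? c ×-dec (3 ℕ.≤? count (λ v → γ v ≟ c)))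
    ... | yes found = found
    ... | no small = contradiction (ℕ.*-cancelˡ-≤ 2 (≤-trans lower upper)) (<⇒≱ surplus)
      where
      stray : ∀ {c p} → Γ c → P p → ∃ λ v → colour α v ≡ p × γ v ≢ c
      stray {c} {p} g pp with any? (λ v → (colour α v ≟ p) ×-dec ¬? (γ v ≟ c))
      ... | yes found = found
      ... | no ¬found = contradiction
        (g , pp , λ v eq → decidable-stable (γ v ≟ c) λ γv≢c → ¬found (v , eq , γv≢c)) (none c p)
      -- No class contains all vertices coloured `p`: the first stray vertex avoids `c₀`, the second
      -- avoids the class of the first.
      twice : ∀ p → P p → 2 ≤ count (λ v → P? p ×-dec (colour α v ≟ p))
      twice p pp =
        let u , αu , _ = stray g₀ pp
            v , αv , γv≢γu = stray (P→Γ (subst P (sym αu) pp)) pp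
        in count-≥2 (λ v → P? p ×-dec (colour α v ≟ p)) (pp , αu) (pp , αv) λ u≡v → γv≢γu (cong γ (sym u≡v))
      -- Vertices in the classes of `Γ` number at least 2 per palette colour and, if no class is
      -- large, at most 2 per class, against the surplus.
      lower : 2 * count P? ≤ 1 * count (Γ? ∘ γ)
      lower = double-count P? (Γ? ∘ γ) (λ p v → P? p ×-dec (colour α v ≟ p)) 2 1 twice
        (λ v _ → count-≤1 (λ p → P? p ×-dec (colour α v ≟ p)) λ { (_ , refl) (_ , refl) → refl })
        (λ { (pp , refl) → P→Γ pp })
      upper : 1 * count (Γ? ∘ γ) ≤ 2 * count Γ?
      upper = double-count (Γ? ∘ γ) Γ? (λ v c → Γ? c ×-dec (γ v ≟ c)) 1 2
        (λ v g → count-pos (λ c → Γ? c ×-dec (γ v ≟ c)) (g , refl))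
        (λ c g → ≤-trans (count-mono (λ v → Γ? c ×-dec (γ v ≟ c)) (λ v → γ v ≟ c) proj₂)
                   (≤-pred (ℕ.≰⇒> λ 3≤ → small (c , g , 3≤))))
        proj₁

    -- Block and complement are completely joined, so no class of γ and no colour of `α` meets both.
    -- Hence `Γ` and `P` split into two independent problems, and a surplus in total is a surplus on
    -- one side.
    split-off-block : Free (Path 3 ⊕ Path 1) G → ∀ {c} → Γ c →
      (t : Fin 3 → Fin n) → (∀ i → γ (t i) ≡ c) → (∀ {i j} → i ≢ j → t i ≢ t j) →
      (∀ {Γ′ : Pred (Fin k) 0ℓ} (Γ′? : Decidable Γ′) →
         (∀ {d} → Γ′ d → Γ d) → ¬ Γ′ c → Solvable Γ′?) →
      Solution α Γ? P
    split-off-block free {c} g t γt≡c t-distinct solve-smaller = by-surplus (count Γʷ? ℕ.<? count Pʷ?)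
      where
      open Triple G free t t-distinct (λ i j e → γ-proper e (trans (γt≡c i) (sym (γt≡c j))))

      MeetsBlock : Pred (Fin k) 0ℓ
      MeetsBlock d = ∃ λ u → γ u ≡ d × InBlock u
      meets? : Decidable MeetsBlock
      meets? d = any? λ u → (γ u ≟ d) ×-dec inBlock? u
      Γʷ? : Decidable (λ d → Γ d × MeetsBlock d)
      Γʷ? d = Γ? d ×-dec meets? d
      Γʳ? : Decidable (λ d → Γ d × ¬ MeetsBlock d)
      Γʳ? d = Γ? d ×-dec ¬? (meets? d)

      Occurs : Pred (Fin ℓ) 0ℓ
      Occurs p = ∃ λ u → colour α u ≡ p × InBlock u
      occurs? : Decidable Occurs
      occurs? p = any? λ u → (colour α u ≟ p) ×-dec inBlock? u
      Pʷ? : Decidable (λ p → P p × Occurs p)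
      Pʷ? p = P? p ×-dec occurs? p
      Pʳ? : Decidable (λ p → P p × ¬ Occurs p)
      Pʳ? p = P? p ×-dec ¬? (occurs? p)

      meets⇒InBlock : ∀ {v} → MeetsBlock (γ v) → InBlock v
      meets⇒InBlock {v} (u , γu≡γv , u∈) = decidable-stable (inBlock? v) λ v∉ →
        γ-proper (Block-complete v∉ u∈) γu≡γv

      Pʷ→Γʷ : ∀ {v} → P (colour α v) × Occurs (colour α v) → Γ (γ v) × MeetsBlock (γ v)
      Pʷ→Γʷ {v} (pp , u , αu≡αv , u∈) = P→Γ pp , v , refl ,
        decidable-stable (inBlock? v) λ v∉ → colour-proper α (Block-complete v∉ u∈) αu≡αv

      Pʳ→Γʳ : ∀ {v} → P (colour α v) × ¬ Occurs (colour α v) → Γ (γ v) × ¬ MeetsBlock (γ v)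
      Pʳ→Γʳ {v} (pp , ¬occurs) = P→Γ pp , λ meets → ¬occurs (v , refl , meets⇒InBlock meets)

      block-solvable : Solvable Γʷ?
      block-solvable = clusters-solvable Γʷ? λ (_ , x) (_ , y) (_ , z) →
        Block-P₃-free (meets⇒InBlock x) (meets⇒InBlock y) (meets⇒InBlock z)

      -- The triple lies in its own block, so `c` is not among the remaining classes and the
      -- induction applies to them.
      rest-solvable : Solvable Γʳ?
      rest-solvable = solve-smaller Γʳ? proj₁ λ (_ , ¬meets) →
        ¬meets (t 0F , γt≡c 0F , 0F , irrefl G refl)

      splitΓ : ∀ {d} → Γ d → (Γ d × MeetsBlock d) ⊎ (Γ d × ¬ MeetsBlock d)
      splitΓ {d} g with meets? d
      ... | yes m = inj₁ (g , m)
      ... | no ¬m = inj₂ (g , ¬m)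

      splitP : ∀ {p} → P p → (P p × Occurs p) ⊎ (P p × ¬ Occurs p)
      splitP {p} pp with occurs? p
      ... | yes o = inj₁ (pp , o)
      ... | no ¬o = inj₂ (pp , ¬o)

      -- The side with a surplus of its own goes first; `compose` then secures one for the other
      -- side.
      by-surplus : Dec (count Γʷ? < count Pʷ?) → Solution α Γ? P
      by-surplus (yes surplusʷ) =
        compose Γ? Γʷ? Γʳ? proj₁ proj₁ splitΓ (λ (_ , m) (_ , ¬m) → ¬m m) α P? proj₁ P→Γ surplus
          (block-solvable α Pʷ? Pʷ→Γʷ surplusʷ) rest-solvable
      by-surplus (no ¬surplusʷ) =
        compose Γ? Γʳ? Γʷ? proj₁ proj₁ (Sum.swap ∘ splitΓ) (λ (_ , ¬m) (_ , m) → ¬m m) α P? proj₁ P→Γ surplus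
          (rest-solvable α Pʳ? Pʳ→Γʳ surplusʳ) block-solvable
        where
        surplusʳ : count Γʳ? < count Pʳ?
        surplusʳ = ℕ.+-cancelˡ-≤ (count Γʷ?) _ _ (begin
          count Γʷ? + suc (count Γʳ?) ≡⟨ ℕ.+-suc (count Γʷ?) _ ⟩
          suc (count Γʷ? + count Γʳ?) ≤⟨ s≤s (count-disjoint Γʷ? Γʳ? Γ? (λ (_ , m) (_ , ¬m) → ¬m m) proj₁ proj₁) ⟩
          suc (count Γ?)              ≤⟨ surplus ⟩
          count P?                    ≤⟨ count-cover Pʷ? Pʳ? P? splitP ⟩
          count Pʷ? + count Pʳ?       ≤⟨ +-monoˡ-≤ _ (≮⇒≥ ¬surplusʷ) ⟩
          count Γʷ? + count Pʳ?       ∎)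
          where open ≤-Reasoning

  -- Induction on the number of classes: a private colour disposes of one class, and the block of a
  -- triple disposes of at least the class of the triple.
  solve : Free (Path 3 ⊕ Path 1) G → ∀ N {Γ : Pred (Fin k) 0ℓ} (Γ? : Decidable Γ) →
          count Γ? ≤ N → Solvable Γ?
  solve free N {Γ} Γ? ≤N α {P} P? P→Γ surplus = by-element N ≤N (any? Γ?)
    where
    by-element : ∀ N → count Γ? ≤ N → Dec (∃ Γ) → Solution α Γ? P
    by-element N ≤N (no empty) = record
      -- `ι` needs values even when `Γ` is empty; the surplus guarantees a palette colour.
      { ι = const (proj₁ (count-nonempty P? (≤-trans (s≤s z≤n) surplus)))
      ; ι∈P = λ g → contradiction (_ , g) empty
      ; ι-inj = λ g → contradiction (_ , g) empty
      ; result = α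
      ; on = λ g → contradiction (_ , g) empty
      ; off = λ _ → refl
      ; walk = ε , z≤n
      }
    by-element zero ≤N (yes (c , g)) = contradiction (≤-trans (count-pos Γ? g) ≤N) λ ()
    by-element (suc N) ≤N (yes inhabited) =
      by-private (any? λ c → any? (private? Γ? α P? P→Γ surplus c))
      where
      solve-smaller : ∀ {c} → Γ c → {Γ′ : Pred (Fin k) 0ℓ} (Γ′? : Decidable Γ′) →
                      (∀ {d} → Γ′ d → Γ d) → ¬ Γ′ c → Solvable Γ′?
      solve-smaller g Γ′? Γ′⊆Γ ¬g′ =
        solve free N Γ′? (≤-pred (≤-trans (count-< Γ′? Γ? Γ′⊆Γ ¬g′ g) ≤N))

      split : ∀ c {d} → Γ d → d ≡ c ⊎ (Γ d × d ≢ c)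
      split c {d} g with d ≟ c
      ... | yes d≡c = inj₁ d≡c
      ... | no d≢c = inj₂ (g , d≢c)

      by-private : Dec (∃ λ c → ∃ (Private Γ? α P? P→Γ surplus c)) → Solution α Γ? P
      by-private (yes (c , p , g , pp , p→c)) =
        compose Γ? (_≟ c) (Γ? -? c) (λ { refl → g }) proj₁ (split c) (λ { refl (_ , ≢c) → ≢c refl })
          α P? (λ { refl → pp }) P→Γ surplus (single-class α c p p→c)
          (solve-smaller g (Γ? -? c) proj₁ (λ (_ , ≢c) → ≢c refl))
      by-private (no none) =
        let c , g , 3≤ = large-class Γ? α P? P→Γ surplus inhabited (λ c p pr → none (c , p , pr))
            t , γt≡c , t-distinct = count-≥3⁻¹ (λ v → γ v ≟ c) 3≤
        in split-off-block Γ? α P? P→Γ surplus free g t γt≡c t-distinct (solve-smaller g)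

-- Renaming the classes of γ, and the walk of length at most 6n

Complete : ∀ k → Graph (Fin k)
Complete k .Adj = _≢_
Complete k .symm = ≢-sym
Complete k .irrefl refl d = d refl
Complete k .adj? x y = ¬? (x ≟ y)

-- Injective maps on the classes are the proper maps on a complete graph, which is itself a single
-- clique. Since `k < ℓ`, some colour is on no class and serves for evictions.
rename-classes : ∀ {ℓ k n} {G : Graph (Fin n)} (γ : Fin n → Fin k) →
  (∀ {u v} → Adj G u v → γ u ≢ γ v) → k < ℓ → (ι κ : Fin k → Fin ℓ) →
  (∀ {c d} → ι c ≡ ι d → c ≡ d) → (∀ {c d} → κ c ≡ κ d → c ≡ d) →
  (α β : Colouring ℓ G) → (∀ v → colour α v ≡ ι (γ v)) → (∀ v → colour β v ≡ κ (γ v)) →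
  WalkWithin (𝓡 ℓ G) (2 * n) α β
rename-classes {ℓ} {k} {n} {G} γ γ-proper k<ℓ ι κ ι-inj κ-inj α β α≡ β≡ =
  let β′ , β′≡ , walk = Q.recolour-quotient κ (λ d → d ∘ κ-inj) (λ _ → yes tt) (λ _ _ _ _ _ d → d) spare
        n ι (count-≤n (λ v → ¬? (ι (γ v) ≟ κ (γ v)))) α α≡ (λ d → d ∘ ι-inj) (λ ¬⊤ → contradiction tt ¬⊤)
  in within-mono (𝓡 ℓ G) (*-monoʳ-≤ 2 (count-≤n (λ v → ¬? (ι (γ v) ≟ κ (γ v)))))
       (subst (WalkWithin (𝓡 ℓ G) _ α) (colour-injective λ v → trans (β′≡ v) (sym (β≡ v))) walk)
  where
  module Q = Quotient {ℓ} {G = G} (Complete k) γ γ-proper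
  spare : ∀ a → Q.ProperMap a → (∀ {x} → ¬ ⊤ → a x ≡ κ x) → ∀ {x} → ⊤ →
          ∃ λ c → c ≢ a x × (∀ y → y ≢ x → a y ≢ c)
  spare a _ _ {x} _ =
    let c , _ , unused = pigeonhole {P = λ _ → ⊤} {Q = λ _ → ⊤} (λ _ → yes tt) (λ _ → yes tt)
          (λ p y → a y ≟ p) (λ { refl refl → refl }) (λ _ → tt)
          (≤-trans (s≤s (count-≤n (λ _ → yes tt))) (≤-trans k<ℓ count-full))
    in c , (λ c≡ → unused x (sym c≡)) , λ y _ → unused y

recolouring-walk : ∀ {ℓ k n} {G : Graph (Fin n)} → Free (Path 3 ⊕ Path 1) G → Colouring k G → k < ℓ →
  (α β : Colouring ℓ G) → WalkWithin (𝓡 ℓ G) (6 * n) α β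
recolouring-walk {ℓ} {k} {n} {G} free γ k<ℓ α β =
  within-mono (𝓡 ℓ G) (≤-reflexive (sym total))
    (within-◅◅ (𝓡 ℓ G) (unify A.walk) (within-◅◅ (𝓡 ℓ G)
      (rename-classes (colour γ) (colour-proper γ) k<ℓ A.ι B.ι (A.ι-inj tt tt) (B.ι-inj tt tt)
        A.result B.result (λ _ → A.on tt) (λ _ → B.on tt))
      (within-reverse (𝓡 ℓ G) (unify B.walk))))
  where
  open Unify {ℓ} (colour γ) (colour-proper γ)
  solution : ∀ α → Solution α {λ _ → ⊤} (λ _ → yes tt) (λ _ → ⊤)
  solution α = solve free k {λ _ → ⊤} (λ _ → yes tt) (count-≤n (λ _ → yes tt)) α (λ _ → yes tt) (λ _ → tt)
    (≤-trans (s≤s (count-≤n (λ _ → yes tt))) (≤-trans k<ℓ count-full))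
  module A = Solution (solution α)
  module B = Solution (solution β)
  unify : ∀ {α α′} → WalkWithin (𝓡 ℓ G) (2 * count {n} (λ _ → yes tt)) α α′ →
          WalkWithin (𝓡 ℓ G) (2 * n) α α′
  unify = within-mono (𝓡 ℓ G) (*-monoʳ-≤ 2 {count {n} {λ _ → ⊤} (λ _ → yes tt)} {n} (count-≤n (λ _ → yes tt)))
  total : 6 * n ≡ 2 * n + (2 * n + 2 * n)
  total = trans (ℕ.*-distribʳ-+ n 2 4) (cong (2 * n +_) (ℕ.*-distribʳ-+ n 2 2))

-- Distances and the diameter

module _ {ℓ n : ℕ} {G : Graph (Fin n)} where

  any-colouring? : {P : Pred (Colouring ℓ G) 0ℓ} → Decidable P → Dec (∃ P)
  any-colouring? {P} P? = map′
    (λ { (xs , p , h) → colouring xs p , h })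
    (λ { (colouring xs p , h) → xs , recompute (proper? G xs) p , h })
    (anyVec? extends?)
    where
    extends? : Decidable (λ xs → Σ (Proper G xs) λ p → P (colouring xs p))
    extends? xs with proper? G xs
    ... | no ¬p = no (¬p ∘ proj₁)
    ... | yes p = map′ (λ h → p , h) (λ { (_ , h) → h }) (P? (colouring xs p))

  _≟ᶜ_ : (α β : Colouring ℓ G) → Dec (α ≡ β)
  α ≟ᶜ β = map′ (λ eq → colour-injective λ v → cong (λ xs → lookup xs v) eq)
                (cong colours) (≡-dec _≟_ (colours α) (colours β))

  WalkOfLength : ℕ → Colouring ℓ G → Colouring ℓ G → Set
  WalkOfLength d α β = ∃ λ (p : Walk (𝓡 ℓ G) α β) → length (𝓡 ℓ G) p ≡ d

  -- Finite search over the next colouring; this lets `least` find the distance from any given walk.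
  walkOfLength? : ∀ d α β → Dec (WalkOfLength d α β)
  walkOfLength? zero α β = map′ (λ { refl → ε , refl }) (λ { (ε , _) → refl }) (α ≟ᶜ β)
  walkOfLength? (suc d) α β = map′
    (λ { (_ , e , p , refl) → e ◅ p , refl })
    (λ { (e ◅ p , refl) → _ , e , p , refl })
    (any-colouring? λ α′ → adj? (𝓡 ℓ G) α α′ ×-dec walkOfLength? d α′ β)

  distance : ∀ α β → Walk (𝓡 ℓ G) α β → ∃ (IsDistance (𝓡 ℓ G) α β)
  distance α β p =
    let d , walk , minimal = least (λ d → walkOfLength? d α β) _ (p , refl)
    in d , walk , λ q → minimal _ (q , refl)

  -- The distances are bounded by `B`, and that from `α₀` to itself shows that there is one, so a
  -- greatest exists.
  bounded⇒diameter : ∀ B → Colouring ℓ G → (∀ α β → WalkWithin (𝓡 ℓ G) B α β) →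
                     ∃ λ D → IsDiameter (𝓡 ℓ G) D × D ≤ B
  bounded⇒diameter B α₀ bound =
    let D , (α , β , attained) , max = greatest
          (λ d → any-colouring? λ α → any-colouring? λ β → dist α β ℕ.≟ d) B
          (λ { (α , β , refl) → dist≤B α β }) (_ , α₀ , α₀ , refl)
    in D
     , ( (λ α β → dist α β , isDistance α β , max (α , β , refl))
       , α , β , subst (IsDistance (𝓡 ℓ G) α β) attained (isDistance α β))
     , ≤-trans (≤-reflexive (sym attained)) (dist≤B α β)
    where
    dist : Colouring ℓ G → Colouring ℓ G → ℕ
    dist α β = proj₁ (distance α β (proj₁ (bound α β)))
    isDistance : ∀ α β → IsDistance (𝓡 ℓ G) α β (dist α β)
    isDistance α β = proj₂ (distance α β (proj₁ (bound α β)))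
    dist≤B : ∀ α β → dist α β ≤ B
    dist≤B α β = ≤-trans (proj₂ (isDistance α β) (proj₁ (bound α β))) (proj₂ (bound α β))

theorem6 : ∀ (n : ℕ) (G : Graph (Fin n)) → Free (Path 3 ⊕ Path 1) G →
    ∀ (ℓ : ℕ) → ℓ ≥ χ G + 1 →
    Connected (𝓡 ℓ G) × (∃[ D ] (IsDiameter (𝓡 ℓ G) D × D ≤ 6 * n))
theorem6 n G free ℓ ℓ≥ = (λ α β → proj₁ (walk α β)) , bounded⇒diameter (6 * n) α₀ walk
  where
  γ : Colouring (χ G) G
  γ = proj₁ (proj₂ (chromaticNumber G))
  χ<ℓ : χ G < ℓ
  χ<ℓ = ≤-trans (≤-reflexive (ℕ.+-comm 1 (χ G))) ℓ≥
  walk : ∀ α β → WalkWithin (𝓡 ℓ G) (6 * n) α β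
  walk = recolouring-walk free γ χ<ℓ
  -- A graph without vertices has no diameter, so some colouring with `ℓ` colours is needed: an
  -- optimal one, read with a larger set of colours.
  α₀ : Colouring ℓ G
  α₀ = colouring (Vec.map (λ c → inject≤ c (ℕ.<⇒≤ χ<ℓ)) (colours γ)) λ u v e eq →
    colour-proper γ e (inject≤-injective _ _ _ _
      (trans (sym (lookup-map u _ (colours γ))) (trans eq (lookup-map v _ (colours γ)))))
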